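{- Let $r\ge 3$ and $0<l<r-1$, and let $d_1,\dots,d_{l-1},d_{l+2},\dots,d_{r-1}\in\{0,1\}$. Then \[ C^{(d_1,\dots,d_{l-1},0,1,d_{l+2},\dots,d_{r-1})}=C^{(d_1,\dots,d_{l-1})}\cdot C^{(1,d_{l+2},\dots,d_{r-1})}. \] Here the left side is a coefficient attached to $\mathbb Z_{\ge0}^r$ (with $r-1$ indices), the first factor to $\mathbb Z_{\ge0}^{l}$ (with $l-1$ indices) and the second to $\mathbb Z_{\ge0}^{r-l}$ (with $r-l-1$ indices).
   Context: Bernoulli numbers $B_n$ are defined by $\sum_{n\ge0}B_n x^n/n! = xe^x/(e^x-1)$ (so $B_1=+1/2$). For $r\ge1$ and a finite set $S\subset\mathbb Z_{\ge0}^r$, put $C(S)=(-1)^r\sum_{(n_1,\dots,n_r)\in S}\prod_{j=1}^r \frac{B_{n_j}}{n_j!}$. For $r\ge1$, $1\le j\le r-1$ define $S^{(0)}_{j,r}=\{(n_1,\dots,n_r)\in\mathbb Z_{\ge0}^r: n_1+\dots+n_r=r,\ n_{j+1}+\dots+n_r\le r-j\}$ and $S^{(1)}_{j,r}=\{(n_1,\dots,n_r)\in\mathbb Z_{\ge0}^r: n_1+\dots+n_r=r,\ n_1+\dots+n_j<j\}$. For $d_1,\dots,d_{r-1}\in\{0,1\}$ let $S^{(d_1,\dots,d_{r-1})}=\bigcap_{j=1}^{r-1}S^{(d_j)}_{j,r}$ (for $r=1$ this is $S^{()}=\{(1)\}\subset\mathbb Z_{\ge0}^1$), and $C^{(d_1,\dots,d_{r-1})}=C(S^{(d_1,\dots,d_{r-1})})$.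 In particular $C^{()}=-1/2$. -}

module Defs where

open import Algebra.Bundles using (CommutativeRing)
open import Data.Fin using (Fin; toℕ)
open import Data.Fin.Patterns using (0F; 1F)
open import Data.Fin.Properties using (all?)
open import Data.Integer.Base using () renaming (+_ to pos)
open import Data.List.Base as List using (List; []; _∷_)
open import Data.List.Membership.Propositional using (_∈_)
open import Data.List.Membership.Propositional.Properties
  using (∈-cartesianProductWith⁺; ∈-upTo⁺; ∈-filter⁺; ∈-filter⁻)
open import Data.List.Relation.Unary.Any using (here)
import Data.List.Relation.Unary.All as All
open import Data.List.Relation.Unary.AllPairs using ([]; _∷_)
open import Data.List.Relation.Unary.Unique.Propositional using (Unique)
import Data.List.Relation.Unary.Unique.Propositional.Properties as Unique
open import Data.Nat.Base as ℕ using (ℕ; zero; suc; _∸_; _!; z≤n; s≤s)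
import Data.Nat.Properties as ℕ
open import Data.Nat.Properties using (_!≢0)
open import Data.Product using (_×_; _,_; proj₂)
open import Data.Rational
  using (ℚ; 0ℚ; 1ℚ; -½; _+_; _-_; _*_; -_; _/_; toℚᵘ)
import Data.Rational.Properties as ℚ
import Data.Rational.Unnormalised.Base as ℚᵘ
import Data.Rational.Unnormalised.Properties as ℚᵘ
open import Data.Vec.Base as Vec using (Vec; []; _∷_)
import Data.Vec.Properties as Vec
open import Function.Base using (_∘_)
open import Function.Bundles using (_⇔_; mk⇔)
open import Relation.Binary.PropositionalEquality
open import Relation.Nullary.Decidable using (_×-dec_)
open import Relation.Unary using (Pred; Decidable)

open import Algebra.Properties.Semiring.Exp
  (CommutativeRing.semiring ℚ.+-*-commutativeRing) using (_^_)

Σℚ : List ℚ → ℚ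
Σℚ = List.foldr _+_ 0ℚ

∏ℚ : ∀ {n} → Vec ℚ n → ℚ
∏ℚ = Vec.foldr′ _*_ 1ℚ

-- The series Σₙ aₙ xⁿ is the function n ↦ aₙ.

PowerSeries : Set
PowerSeries = ℕ → ℚ

infixl 7 _⊛_
infixl 6 _⊖_

_⊛_ : PowerSeries → PowerSeries → PowerSeries
(f ⊛ g) n = Σℚ (List.applyUpTo (λ k → f (n ∸ k) * g k) (suc n))

_⊖_ : PowerSeries → PowerSeries → PowerSeries
(f ⊖ g) n = f n - g n

x·_ : PowerSeries → PowerSeries
(x· f) zero    = 0ℚ
(x· f) (suc n) = f n

one : PowerSeries
one zero    = 1ℚ
one (suc _) = 0ℚ

1/_! : ℕ → ℚ
1/ n ! = _/_ (pos 1) (n !) {{n !≢0}}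

expₓ : PowerSeries
expₓ n = 1/ n !

-- The quotient f / g of power series, for g with constant term 1:
-- qₙ = fₙ - Σ_{k<n} qₙ₋₁₋ₖ gₖ₊₁.

module Quotient (f g : PowerSeries) where

  mutual
    quotient : PowerSeries
    quotient n = f n - Σℚ (List.zipWith _*_ (earlier n) (List.applyUpTo (g ∘ suc) n))

    -- qₙ₋₁ , … , q₀
    earlier : ℕ → List ℚ
    earlier zero    = []
    earlier (suc n) = quotient n ∷ earlier n

open Quotient public using (quotient)

-- x eˣ / (eˣ - 1) is computed as eˣ / h, where h = (eˣ - 1) / x = Σₙ xⁿ / (n+1)!.

B : ℕ → ℚ
B n = (pos (n !) / 1) * quotient expₓ (λ k → 1/ suc k !) n

B/! : ℕ → ℚ
B/! n = B n * 1/ n !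

-- A finite subset of ℤ≥0^r, listed without repetitions.

record FiniteSet (r : ℕ) : Set where
  field
    elements : List (Vec ℕ r)
    unique   : Unique elements

C : ∀ {r} → FiniteSet r → ℚ
C {r} S = (- 1ℚ) ^ r * Σℚ (List.map (λ n → ∏ℚ (Vec.map B/! n)) (FiniteSet.elements S))

-- n₁ + ⋯ + nⱼ and nⱼ₊₁ + ⋯ + nᵣ

headSum tailSum : ∀ {r} → ℕ → Vec ℕ r → ℕ
headSum j n = List.sum (List.take j (Vec.toList n))
tailSum j n = List.sum (List.drop j (Vec.toList n))

Bit : Set
Bit = Fin 2

S⟨_⟩ : Bit → (j r : ℕ) → Pred (Vec ℕ r) _
S⟨ 0F ⟩ j r n = Vec.sum n ≡ r × tailSum j n ℕ.≤ r ∸ j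
S⟨ 1F ⟩ j r n = Vec.sum n ≡ r × headSum j n ℕ.< j

-- The intersection of the sets S⟨ dⱼ ⟩ j r over the entries dⱼ of d; the
-- intended length of d is m = r - 1.  The first conjunct is implied by the
-- second unless d is empty, where it gives S r [] = {(1)} for r = 1.
-- Positions in d are numbered from 0, so that dⱼ is the entry at j - 1.

S : (r : ℕ) → ∀ {m} → Vec Bit m → Pred (Vec ℕ r) _
S r {m} d n = Vec.sum n ≡ r × (∀ (i : Fin m) → S⟨ Vec.lookup d i ⟩ (suc (toℕ i)) r n)

S⟨_⟩? : ∀ b j r → Decidable (S⟨ b ⟩ j r)
S⟨ 0F ⟩? j r n = (Vec.sum n ℕ.≟ r) ×-dec (tailSum j n ℕ.≤? r ∸ j)
S⟨ 1F ⟩? j r n = (Vec.sum n ℕ.≟ r) ×-dec (headSum j n ℕ.<? j)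

S? : ∀ r {m} (d : Vec Bit m) → Decidable (S r d)
S? r d n = (Vec.sum n ℕ.≟ r) ×-dec all? (λ i → S⟨ Vec.lookup d i ⟩? (suc (toℕ i)) r n)

-- {0,…,b}^k

box : (k b : ℕ) → List (Vec ℕ k)
box zero    b = [] ∷ []
box (suc k) b = List.cartesianProductWith _∷_ (List.upTo (suc b)) (box k b)

box-unique : ∀ k b → Unique (box k b)
box-unique zero    b = All.[] ∷ []
box-unique (suc k) b =
  Unique.cartesianProductWith⁺ _∷_ Vec.∷-injective (Unique.upTo⁺ (suc b)) (box-unique k b)

∈-box : ∀ {k b} (n : Vec ℕ k) → Vec.sum n ℕ.≤ b → n ∈ box k b
∈-box []      _ = here refl
∈-box (a ∷ n) p =
  ∈-cartesianProductWith⁺ _∷_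
    (∈-upTo⁺ (s≤s (ℕ.m+n≤o⇒m≤o a p)))
    (∈-box n (ℕ.m+n≤o⇒n≤o a p))

finiteS : (r : ℕ) → ∀ {m} → Vec Bit m → FiniteSet r
finiteS r d = record
  { elements = List.filter (S? r d) (box r r)
  ; unique   = Unique.filter⁺ (S? r d) (box-unique r r)
  }

∈-finiteS : ∀ r {m} (d : Vec Bit m) (n : Vec ℕ r) →
            n ∈ FiniteSet.elements (finiteS r d) ⇔ S r d n
∈-finiteS r d n = mk⇔
  (λ n∈ → proj₂ (∈-filter⁻ (S? r d) {xs = box r r} n∈))
  (λ s@(Σn≡r , _) → ∈-filter⁺ (S? r d) (∈-box n (ℕ.≤-reflexive Σn≡r)) s)

C⟨_⟩ : (r : ℕ) → ∀ {m} → Vec Bit m → ℚ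
C⟨ r ⟩ d = C (finiteS r d)

C-empty : C⟨ 1 ⟩ [] ≡ -½
C-empty = refl

private
  zipWith-earlier : ∀ f g (h : ℕ → ℚ) n →
    List.zipWith _*_ (Quotient.earlier f g n) (List.applyUpTo h n)
      ≡ List.applyUpTo (λ k → quotient f g (n ∸ suc k) * h k) n
  zipWith-earlier f g h zero    = refl
  zipWith-earlier f g h (suc n) = cong (quotient f g n * h 0 ∷_) (zipWith-earlier f g (h ∘ suc) n)

  applyUpTo-cong : ∀ {f g : ℕ → ℚ} → f ≗ g → ∀ n → List.applyUpTo f n ≡ List.applyUpTo g n
  applyUpTo-cong f≗g zero    = refl
  applyUpTo-cong f≗g (suc n) = cong₂ _∷_ (f≗g 0) (applyUpTo-cong (f≗g ∘ suc) n)

  p-q+q : ∀ p q → p - q + q ≡ p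
  p-q+q p q = begin
    p - q + q      ≡⟨ ℚ.+-assoc p (- q) q ⟩
    p + (- q + q)  ≡⟨ cong (p +_) (ℚ.+-inverseˡ q) ⟩
    p + 0ℚ         ≡⟨ ℚ.+-identityʳ p ⟩
    p              ∎
    where open ≡-Reasoning

  [n/1]*[1/n] : ∀ n .{{_ : ℕ.NonZero n}} → (pos n / 1) * (pos 1 / n) ≡ 1ℚ
  [n/1]*[1/n] n@(suc m) = ℚ.toℚᵘ-injective (begin
    toℚᵘ ((pos n / 1) * (pos 1 / n))           ≈⟨ ℚ.toℚᵘ-homo-* (pos n / 1) (pos 1 / n) ⟩
    toℚᵘ (pos n / 1) ℚᵘ.* toℚᵘ (pos 1 / n)     ≈⟨ ℚᵘ.*-cong (ℚ.toℚᵘ-fromℚᵘ (ℚᵘ.mkℚᵘ (pos n) 0))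
                                                            (ℚ.toℚᵘ-fromℚᵘ (ℚᵘ.mkℚᵘ (pos 1) m)) ⟩
    ℚᵘ.mkℚᵘ (pos n) 0 ℚᵘ.* ℚᵘ.mkℚᵘ (pos 1) m   ≈⟨ ℚᵘ.*-inverseʳ (ℚᵘ.mkℚᵘ (pos n) 0) ⟩
    toℚᵘ 1ℚ                                    ∎)
    where open ℚᵘ.≃-Reasoning

quotient-⊛ : ∀ f g → g 0 ≡ 1ℚ → quotient f g ⊛ g ≗ f
quotient-⊛ f g g₀≡1 n = begin
  quotient f g n * g 0 + Σℚ (List.applyUpTo (λ k → quotient f g (n ∸ suc k) * g (suc k)) n)
    ≡⟨ cong₂ _+_ (trans (cong (quotient f g n *_) g₀≡1) (ℚ.*-identityʳ (quotient f g n)))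
                 (cong Σℚ (sym (zipWith-earlier f g (g ∘ suc) n))) ⟩
  quotient f g n + Σℚ (List.zipWith _*_ (Quotient.earlier f g n) (List.applyUpTo (g ∘ suc) n))
    ≡⟨ p-q+q (f n) (Σℚ (List.zipWith _*_ (Quotient.earlier f g n) (List.applyUpTo (g ∘ suc) n))) ⟩
  f n ∎
  where open ≡-Reasoning

B/!-quotient : B/! ≗ quotient expₓ (λ k → 1/ suc k !)
B/!-quotient n = begin
  N * q * 1/ n !    ≡⟨ cong (_* 1/ n !) (ℚ.*-comm N q) ⟩
  q * N * 1/ n !    ≡⟨ ℚ.*-assoc q N (1/ n !) ⟩
  q * (N * 1/ n !)  ≡⟨ cong (q *_) ([n/1]*[1/n] (n !) {{n !≢0}}) ⟩
  q * 1ℚ            ≡⟨ ℚ.*-identityʳ q ⟩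
  q                 ∎
  where
  open ≡-Reasoning
  N = pos (n !) / 1
  q = quotient expₓ (λ k → 1/ suc k !) n

-- (Σₙ Bₙ xⁿ / n!) (eˣ - 1) = x eˣ

B-generating-function : B/! ⊛ (expₓ ⊖ one) ≗ x· expₓ
B-generating-function zero    = refl
B-generating-function (suc n) = begin
  B/! (suc n) * 0ℚ + Σℚ (List.applyUpTo (λ k → B/! (n ∸ k) * (1/ suc k ! - 0ℚ)) (suc n))
    ≡⟨ cong₂ _+_ (ℚ.*-zeroʳ (B/! (suc n)))
         (cong Σℚ (applyUpTo-cong (λ k → cong₂ _*_ (B/!-quotient (n ∸ k)) (ℚ.+-identityʳ (h k))) (suc n))) ⟩
  0ℚ + (quotient expₓ h ⊛ h) n
    ≡⟨ ℚ.+-identityˡ ((quotient expₓ h ⊛ h) n) ⟩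
  (quotient expₓ h ⊛ h) n
    ≡⟨ quotient-⊛ expₓ h refl n ⟩
  expₓ n ∎
  where
  open ≡-Reasoning
  h : PowerSeries
  h k = 1/ suc k !

{-# OPTIONS --safe #-}

-- Given Σn = r, the condition with dⱼ = 0 says n₁ + ⋯ + nⱼ ≥ j.  So d_l = 0 and
-- d_{l+1} = 1 read l ≤ n₁ + ⋯ + n_l ≤ n₁ + ⋯ + n_{l+1} ≤ l, that is
-- n₁ + ⋯ + n_l = l and n_{l+1} = 0, and then the remaining conditions split into
-- those on (n₁,…,n_l) and those on (n_{l+1},…,n_r).  Concatenation is thus a
-- bijection of the product of the two smaller index sets onto the large one.

module Submission where

open import Defs
open import Data.Nat using (ℕ; _≤_; _<_; _∸_)
open import Data.Fin.Patterns using (0F; 1F)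
open import Data.Vec using (Vec; _∷_; _++_)
open import Data.Rational using (_*_)
open import Relation.Binary.PropositionalEquality using (_≡_)

open import Algebra.Bundles using (CommutativeRing; CommutativeMonoid)
import Algebra.Properties.CommutativeSemigroup as CommutativeSemigroup
open import Data.Fin using (Fin; toℕ; _↑ˡ_; _↑ʳ_; join; splitAt)
open import Data.Fin.Properties using (toℕ<n; toℕ-↑ˡ; toℕ-↑ʳ; join-splitAt)
import Data.List.Base as List
import Data.List.Properties as List
open import Data.List.Membership.Propositional using (_∈_)
open import Data.List.Membership.Propositional.Properties
  using (∈-cartesianProductWith⁺; ∈-cartesianProductWith⁻)
open import Data.List.Membership.Propositional.Properties.WithK using (unique∧set⇒bag)
open import Data.List.Relation.Binary.BagAndSetEquality using (∼bag⇒↭)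
open import Data.List.Relation.Binary.Permutation.Propositional using (_↭_; ↭⇒↭ₛ)
open import Data.List.Relation.Binary.Permutation.Propositional.Properties using (map⁺)
import Data.List.Relation.Binary.Permutation.Setoid.Properties as Permutation
import Data.List.Relation.Unary.Unique.Propositional.Properties as Unique
open import Data.Nat.Base using (zero; suc; _+_; z≤n; s≤s)
import Data.Nat.Properties as ℕ
open import Data.Product using (_×_; _,_)
open import Data.Rational using (ℚ; 1ℚ; -_) renaming (_+_ to _+ℚ_)
import Data.Rational.Properties as ℚ
open import Data.Sum using (inj₁; inj₂)
open import Data.Vec.Base as Vec using ([])
import Data.Vec.Properties as Vec
open import Function.Base using (id; _∘_)
open import Function.Bundles using (_⇔_; mk⇔; Equivalence)
open import Relation.Binary.PropositionalEquality
  using (refl; sym; trans; cong; cong₂; subst; setoid; module ≡-Reasoning)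

open import Algebra.Properties.Semiring.Exp
  (CommutativeRing.semiring ℚ.+-*-commutativeRing) using (_^_; ^-homo-*)

open Equivalence using (to; from)
open FiniteSet

-- Sums, products and the multiplicativity of `C`

Σ-↭ : ∀ {xs ys} → xs ↭ ys → Σℚ xs ≡ Σℚ ys
Σ-↭ xs↭ys = Permutation.foldr-commMonoid (setoid ℚ)
  (CommutativeMonoid.isCommutativeMonoid ℚ.+-0-commutativeMonoid) (↭⇒↭ₛ xs↭ys)

Σ-++ : ∀ xs ys → Σℚ (xs List.++ ys) ≡ Σℚ xs +ℚ Σℚ ys
Σ-++ List.[]       ys = sym (ℚ.+-identityˡ (Σℚ ys))
Σ-++ (x List.∷ xs) ys =
  trans (cong (x +ℚ_) (Σ-++ xs ys)) (sym (ℚ.+-assoc x (Σℚ xs) (Σℚ ys)))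

∏-++ : ∀ {a b} (x : Vec ℚ a) (y : Vec ℚ b) → ∏ℚ (x ++ y) ≡ ∏ℚ x * ∏ℚ y
∏-++ []      y = sym (ℚ.*-identityˡ (∏ℚ y))
∏-++ (q ∷ x) y = trans (cong (q *_) (∏-++ x y)) (sym (ℚ.*-assoc q (∏ℚ x) (∏ℚ y)))

module _ {A B C : Set} {f : A → B → C} {u : A → ℚ} {v : B → ℚ} {w : C → ℚ}
         (w-f : ∀ x y → w (f x y) ≡ u x * v y) where

  Σ-map-* : ∀ x ys → Σℚ (List.map w (List.map (f x) ys)) ≡ u x * Σℚ (List.map v ys)
  Σ-map-* x List.[]       = sym (ℚ.*-zeroʳ (u x))
  Σ-map-* x (y List.∷ ys) = trans (cong₂ _+ℚ_ (w-f x y) (Σ-map-* x ys))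
    (sym (ℚ.*-distribˡ-+ (u x) (v y) (Σℚ (List.map v ys))))

  Σ-cartesianProductWith : ∀ xs ys →
    Σℚ (List.map w (List.cartesianProductWith f xs ys))
      ≡ Σℚ (List.map u xs) * Σℚ (List.map v ys)
  Σ-cartesianProductWith List.[]       ys = sym (ℚ.*-zeroˡ (Σℚ (List.map v ys)))
  Σ-cartesianProductWith (x List.∷ xs) ys = begin
    Σℚ (List.map w (List.map (f x) ys List.++ rest))
      ≡⟨ cong Σℚ (List.map-++ w (List.map (f x) ys) rest) ⟩
    Σℚ (List.map w (List.map (f x) ys) List.++ List.map w rest)
      ≡⟨ Σ-++ (List.map w (List.map (f x) ys)) (List.map w rest) ⟩
    Σℚ (List.map w (List.map (f x) ys)) +ℚ Σℚ (List.map w rest)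
      ≡⟨ cong₂ _+ℚ_ (Σ-map-* x ys) (Σ-cartesianProductWith xs ys) ⟩
    u x * Σv +ℚ Σℚ (List.map u xs) * Σv
      ≡⟨ ℚ.*-distribʳ-+ Σv (u x) (Σℚ (List.map u xs)) ⟨
    (u x +ℚ Σℚ (List.map u xs)) * Σv ∎
    where
    open ≡-Reasoning
    rest = List.cartesianProductWith f xs ys
    Σv   = Σℚ (List.map v ys)

-- The product of the `B/!` is multiplicative under concatenation, so distributivity splits the sum;
-- the sign splits as a power of `- 1ℚ`.
C-product : ∀ {a b} (X : FiniteSet a) (Y : FiniteSet b) (Z : FiniteSet (a + b)) →
            elements Z ↭ List.cartesianProductWith _++_ (elements X) (elements Y) →
            C Z ≡ C X * C Y
C-product {a} {b} X Y Z Z↭X×Y = begin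
  (- 1ℚ) ^ (a + b) * Σℚ (List.map weight (elements Z))
    ≡⟨ cong₂ _*_ (^-homo-* (- 1ℚ) a b)
         (trans (Σ-↭ (map⁺ weight Z↭X×Y))
                (Σ-cartesianProductWith weight-++ (elements X) (elements Y))) ⟩
  (- 1ℚ) ^ a * (- 1ℚ) ^ b * (Σℚ (List.map weight (elements X)) * Σℚ (List.map weight (elements Y)))
    ≡⟨ CommutativeSemigroup.interchange
         (CommutativeMonoid.commutativeSemigroup ℚ.*-1-commutativeMonoid)
         ((- 1ℚ) ^ a) ((- 1ℚ) ^ b) _ _ ⟩
  C X * C Y ∎
  where
  open ≡-Reasoning
  weight : ∀ {r} → Vec ℕ r → ℚ
  weight n = ∏ℚ (Vec.map B/! n)
  weight-++ : ∀ (x : Vec ℕ a) (y : Vec ℕ b) → weight (x ++ y) ≡ weight x * weight y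
  weight-++ x y = trans (cong ∏ℚ (Vec.map-++ B/! x y)) (∏-++ (Vec.map B/! x) (Vec.map B/! y))

-- Head sums, and the conditions as bounds on them

headSum-++ˡ : ∀ {j a b} → j ≤ a → (x : Vec ℕ a) (y : Vec ℕ b) →
              headSum j (x ++ y) ≡ headSum j x
headSum-++ˡ {zero}  _         x       y = refl
headSum-++ˡ {suc j} (s≤s j≤a) (n ∷ x) y = cong (n +_) (headSum-++ˡ j≤a x y)

headSum-++ʳ : ∀ {a b} j (x : Vec ℕ a) (y : Vec ℕ b) →
              headSum (a + j) (x ++ y) ≡ Vec.sum x + headSum j y
headSum-++ʳ j []      y = refl
headSum-++ʳ j (n ∷ x) y =
  trans (cong (n +_) (headSum-++ʳ j x y)) (sym (ℕ.+-assoc n (Vec.sum x) (headSum j y)))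

headSum+tailSum : ∀ {r} j (n : Vec ℕ r) → headSum j n + tailSum j n ≡ Vec.sum n
headSum+tailSum zero    []      = refl
headSum+tailSum zero    (a ∷ n) = cong (a +_) (headSum+tailSum zero n)
headSum+tailSum (suc j) []      = refl
headSum+tailSum (suc j) (a ∷ n) =
  trans (ℕ.+-assoc a (headSum j n) (tailSum j n)) (cong (a +_) (headSum+tailSum j n))

tailSum≡ : ∀ {r s} j (n : Vec ℕ r) → Vec.sum n ≡ s → tailSum j n ≡ s ∸ headSum j n
tailSum≡ {s = s} j n Σn≡s = begin
  tailSum j n                               ≡⟨ ℕ.m+n∸m≡n (headSum j n) (tailSum j n) ⟨
  headSum j n + tailSum j n ∸ headSum j n   ≡⟨ cong (_∸ headSum j n) (trans (headSum+tailSum j n) Σn≡s) ⟩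
  s ∸ headSum j n                           ∎
  where open ≡-Reasoning

-- Once the total is fixed, both kinds of condition compare `j` with `h`, the head sum. In this form
-- they survive a common shift of `j` and `h`, which tail sums would hide.
HeadBound : Bit → (j h : ℕ) → Set
HeadBound 0F j h = j ≤ h
HeadBound 1F j h = h < j

HeadBound-+ : ∀ c b {j h} → HeadBound b (c + j) (c + h) ⇔ HeadBound b j h
HeadBound-+ c 0F = mk⇔ (ℕ.+-cancelˡ-≤ c _ _) (ℕ.+-monoʳ-≤ c)
HeadBound-+ c 1F = mk⇔ (ℕ.+-cancelˡ-< c _ _) (ℕ.+-monoʳ-< c)

-- For `0F` the tail sum is `r ∸ headSum j n`, and subtraction from `r` reverses order. The
-- hypothesis `j ≤ r` keeps `r ∸ j` from being truncated, so the comparison can be undone.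
S⟨⟩⇔HeadBound : ∀ b {j r} {n : Vec ℕ r} → j ≤ r → Vec.sum n ≡ r →
                S⟨ b ⟩ j r n ⇔ HeadBound b j (headSum j n)
S⟨⟩⇔HeadBound 0F {j} {r} {n} j≤r Σn≡r = mk⇔
  (λ (_ , t≤) → ℕ.∸-cancelʳ-≤ j≤r (subst (_≤ r ∸ j) (tailSum≡ j n Σn≡r) t≤))
  (λ j≤h → Σn≡r , subst (_≤ r ∸ j) (sym (tailSum≡ j n Σn≡r)) (ℕ.∸-monoʳ-≤ r j≤h))
S⟨⟩⇔HeadBound 1F _ Σn≡r = mk⇔ (λ (_ , h<j) → h<j) (λ h<j → Σn≡r , h<j)

HeadBounds : ∀ {m r} → Vec Bit m → Vec ℕ r → Set
HeadBounds {m} d n =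
  ∀ (i : Fin m) → HeadBound (Vec.lookup d i) (suc (toℕ i)) (headSum (suc (toℕ i)) n)

S⇔HeadBounds : ∀ {m r} (d : Vec Bit m) (n : Vec ℕ r) → m < r →
               S r d n ⇔ (Vec.sum n ≡ r × HeadBounds d n)
S⇔HeadBounds {m} {r} d n m<r = mk⇔
  (λ (Σn≡r , s) → Σn≡r , λ i → to (S⟨⟩⇔HeadBound (Vec.lookup d i) (bound i) Σn≡r) (s i))
  (λ (Σn≡r , s) → Σn≡r , λ i → from (S⟨⟩⇔HeadBound (Vec.lookup d i) (bound i) Σn≡r) (s i))
  where
  bound : ∀ (i : Fin m) → suc (toℕ i) ≤ r
  bound i = ℕ.≤-trans (toℕ<n i) (ℕ.<⇒≤ m<r)

-- The conditions that remain after a prefix with `j` entries and sum `h`. The first bit of `f` sits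
-- exactly at the boundary: its head sum is `h`, with no entry of `y`.
HeadBoundsFrom : ∀ {m r} (j h : ℕ) → Vec Bit m → Vec ℕ r → Set
HeadBoundsFrom {m} j h f y =
  ∀ (i : Fin m) → HeadBound (Vec.lookup f i) (j + toℕ i) (h + headSum (toℕ i) y)

-- As `x` is one longer than `d`, the bits of `d` see only entries of `x`, while every bit of `f`
-- sees all of `x`.
HeadBounds-++ : ∀ {p q b} (d : Vec Bit p) (f : Vec Bit q) (x : Vec ℕ (suc p)) (y : Vec ℕ b) →
  HeadBounds (d ++ f) (x ++ y) ⇔
  (HeadBounds d x × HeadBoundsFrom (suc p) (Vec.sum x) f y)
HeadBounds-++ {p} {q} d f x y = mk⇔
  (λ s → (λ i → subst id (left i) (s (i ↑ˡ q))) , (λ i → subst id (right i) (s (p ↑ʳ i))))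
  (λ s i → subst Bound (join-splitAt p q i) (glue s (splitAt p i)))
  where
  Bound : Fin (p + q) → Set
  Bound i = HeadBound (Vec.lookup (d ++ f) i) (suc (toℕ i)) (headSum (suc (toℕ i)) (x ++ y))

  left : ∀ i → Bound (i ↑ˡ q) ≡
               HeadBound (Vec.lookup d i) (suc (toℕ i)) (headSum (suc (toℕ i)) x)
  left i rewrite Vec.lookup-++ˡ d f i | toℕ-↑ˡ i q
               | headSum-++ˡ (s≤s (ℕ.<⇒≤ (toℕ<n i))) x y = refl

  right : ∀ i → Bound (p ↑ʳ i) ≡
                HeadBound (Vec.lookup f i) (suc p + toℕ i) (Vec.sum x + headSum (toℕ i) y)
  right i rewrite Vec.lookup-++ʳ d f i | toℕ-↑ʳ p i
                | headSum-++ʳ (toℕ i) x y = refl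

  glue : HeadBounds d x × HeadBoundsFrom (suc p) (Vec.sum x) f y → ∀ i → Bound (join p q i)
  glue (s , _) (inj₁ i) = subst id (sym (left i)) (s i)
  glue (_ , s) (inj₂ i) = subst id (sym (right i)) (s i)

-- Splitting the index set at a 0 followed by a 1

S-++ : ∀ {p q} (d : Vec Bit p) (e : Vec Bit q)
       (x : Vec ℕ (suc p)) (y : Vec ℕ (suc (suc q))) →
       S (suc p + suc (suc q)) (d ++ 0F ∷ 1F ∷ e) (x ++ y) ⇔
       (S (suc p) d x × S (suc (suc q)) (1F ∷ e) y)
S-++ {p} {q} d e x y = mk⇔ split merge
  where
  a = suc p
  b = suc (suc q)

  whole = S⇔HeadBounds (d ++ 0F ∷ 1F ∷ e) (x ++ y) ℕ.≤-refl
  left  = S⇔HeadBounds d x ℕ.≤-refl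
  right = S⇔HeadBounds (1F ∷ e) y ℕ.≤-refl
  parts = HeadBounds-++ d (0F ∷ 1F ∷ e) x y

  split : S (a + b) (d ++ 0F ∷ 1F ∷ e) (x ++ y) → S a d x × S b (1F ∷ e) y
  split s = let Σ≡ , h = to whole s; hx , hy = to parts h in go Σ≡ hx hy
    where
    go : Vec.sum (x ++ y) ≡ a + b → HeadBounds d x →
         HeadBoundsFrom a (Vec.sum x) (0F ∷ 1F ∷ e) y →
         S a d x × S b (1F ∷ e) y
    go Σ≡ hx hy = from left (Σx≡a , hx) , from right (Σy≡b , hy′)
      where
      -- The bit `0F` reads `a + 0 ≤ Vec.sum x + 0`.
      a≤Σx : a ≤ Vec.sum x
      a≤Σx = ℕ.+-cancelʳ-≤ 0 a (Vec.sum x) (hy 0F)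

      -- The bit `1F` bounds the sum of `x` and the first entry of `y` strictly by `a + 1`.
      Σx≤a : Vec.sum x ≤ a
      Σx≤a = ℕ.m<1+n⇒m≤n (ℕ.≤-<-trans (ℕ.m≤m+n (Vec.sum x) (headSum 1 y))
               (subst (Vec.sum x + headSum 1 y <_) (ℕ.+-comm a 1) (hy 1F)))

      Σx≡a : Vec.sum x ≡ a
      Σx≡a = ℕ.≤-antisym Σx≤a a≤Σx

      Σy≡b : Vec.sum y ≡ b
      Σy≡b = ℕ.+-cancelˡ-≡ a _ _
        (trans (cong (_+ Vec.sum y) (sym Σx≡a)) (trans (sym (Vec.sum-++ x)) Σ≡))

      -- With `Vec.sum x` equal to `a`, the bits after `0F` have `a` on both sides of their
      -- comparisons, and it cancels.
      hy′ : HeadBounds (1F ∷ e) y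
      hy′ i = to (HeadBound-+ a (Vec.lookup (1F ∷ e) i))
        (subst (λ h → HeadBoundsFrom a h (0F ∷ 1F ∷ e) y) Σx≡a hy (Fin.suc i))

  merge : S a d x × S b (1F ∷ e) y → S (a + b) (d ++ 0F ∷ 1F ∷ e) (x ++ y)
  merge (sx , sy) = let Σx≡a , hx = to left sx; Σy≡b , hy = to right sy in
    from whole (trans (Vec.sum-++ x) (cong₂ _+_ Σx≡a Σy≡b) ,
                from parts (hx , subst (λ h → HeadBoundsFrom a h (0F ∷ 1F ∷ e) y) (sym Σx≡a) (go hy)))
    where
    go : HeadBounds (1F ∷ e) y → HeadBoundsFrom a a (0F ∷ 1F ∷ e) y
    -- The bit `0F` has no counterpart in the factors; it holds with equality.
    go hy Fin.zero    = ℕ.≤-refl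
    go hy (Fin.suc i) = from (HeadBound-+ a (Vec.lookup (1F ∷ e) i)) (hy i)

-- Two lists without repetitions and with the same members are permutations of each other. The
-- product list has no repetitions because `_++_` is injective for fixed lengths.
finiteS-++ : ∀ {p q} (d : Vec Bit p) (e : Vec Bit q) →
  elements (finiteS (suc p + suc (suc q)) (d ++ 0F ∷ 1F ∷ e)) ↭
  List.cartesianProductWith _++_ (elements (finiteS (suc p) d))
                                 (elements (finiteS (suc (suc q)) (1F ∷ e)))
finiteS-++ {p} {q} d e = ∼bag⇒↭ (unique∧set⇒bag (unique Z)
  (Unique.cartesianProductWith⁺ _++_ (Vec.++-injective _ _) (unique X) (unique Y))
  (λ {n} → mk⇔ (split n ∘ to (∈-finiteS r (d ++ 0F ∷ 1F ∷ e) n)) merge))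
  where
  r = suc p + suc (suc q)
  X = finiteS (suc p) d
  Y = finiteS (suc (suc q)) (1F ∷ e)
  Z = finiteS r (d ++ 0F ∷ 1F ∷ e)

  split : ∀ n → S r (d ++ 0F ∷ 1F ∷ e) n →
          n ∈ List.cartesianProductWith _++_ (elements X) (elements Y)
  split n s with Vec.splitAt (suc p) n
  ... | x , y , refl = let sx , sy = to (S-++ d e x y) s in
    ∈-cartesianProductWith⁺ _++_ (from (∈-finiteS _ d x) sx) (from (∈-finiteS _ (1F ∷ e) y) sy)

  merge : ∀ {n} → n ∈ List.cartesianProductWith _++_ (elements X) (elements Y) →
          n ∈ elements Z
  merge n∈ with ∈-cartesianProductWith⁻ _++_ (elements X) (elements Y) n∈
  ... | x , y , x∈X , y∈Y , refl = from (∈-finiteS r (d ++ 0F ∷ 1F ∷ e) (x ++ y))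
    (from (S-++ d e x y) (to (∈-finiteS _ d x) x∈X , to (∈-finiteS _ (1F ∷ e) y) y∈Y))

-- A variable `b` in place of `r ∸ l` allows matching on `l` and `b`, after which the lengths
-- `l ∸ 1` and `b ∸ 2` compute.
C-++ : ∀ {r} l b → r ≡ l + b → 0 < l → 1 < b → (d : Vec Bit (l ∸ 1)) (e : Vec Bit (b ∸ 2)) →
       C⟨ r ⟩ (d ++ 0F ∷ 1F ∷ e) ≡ C⟨ l ⟩ d * C⟨ b ⟩ (1F ∷ e)
C-++ (suc p) (suc (suc q)) refl _ _ d e =
  C-product (finiteS (suc p) d) (finiteS (suc (suc q)) (1F ∷ e))
            (finiteS _ (d ++ 0F ∷ 1F ∷ e)) (finiteS-++ d e)
C-++ (suc p) (suc zero) _ _ (s≤s ())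

theorem2p3 : (r l : ℕ) → 3 ≤ r → 0 < l → l < r ∸ 1 →
    (d : Vec Bit (l ∸ 1)) (e : Vec Bit (r ∸ l ∸ 2)) →
    C⟨ r ⟩ (d ++ 0F ∷ 1F ∷ e) ≡ C⟨ l ⟩ d * C⟨ r ∸ l ⟩ (1F ∷ e)
theorem2p3 r l 3≤r 0<l l<r∸1 =
  C-++ l (r ∸ l) (sym (ℕ.m+[n∸m]≡n l≤r)) 0<l (ℕ.m+n≤o⇒m≤o∸n 2 2+l≤r)
  where
  -- Moving the 1 across `l < r ∸ 1` needs `1 ≤ r`, which `3≤r` supplies.
  2+l≤r : 2 + l ≤ r
  2+l≤r = subst (_≤ r) (ℕ.+-comm (suc l) 1)
    (ℕ.m≤o∸n⇒m+n≤o (suc l) (ℕ.≤-trans (s≤s z≤n) 3≤r) l<r∸1)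
  l≤r : l ≤ r
  l≤r = ℕ.m+n≤o⇒n≤o 2 2+l≤r
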